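{- Let $D_{(=,\leq)}(x)$ be the generating function, with respect to the length, for the total number of descents over all Catalan words avoiding the ordered pair of relations $(=,\leq)$. Then $$D_{(=,\leq)}(x)=\frac{1 - 2 x - x^2 - 2 x^3 -(1-x) \sqrt{1 - 2 x - 3 x^2 - 4 x^3}}{2 x\sqrt{1 - 2 x - 3 x^2 - 4 x^3}}.$$
   Context: A Catalan word of length $n$ is a word $w=w_1w_2\cdots w_n$ over the non-negative integers with $w_1=0$ and $0\leq w_i\leq w_{i-1}+1$ for $i=2,\dots,n$; the empty word is the unique Catalan word of length $0$. For relations $X,Y\in\{<,>,\leq,\geq,=,\neq\}$, a word $w$ contains the pattern $(X,Y)$ if there is an index $i\geq 1$ (with $i+2\le n$) such that $w_i\,X\,w_{i+1}$ and $w_{i+1}\,Y\,w_{i+2}$; otherwise $w$ avoids $(X,Y)$. The number of descents $\mathrm{des}(w)$ is the number of indices $i$ with $w_i>w_{i+1}$. With $C_{(X,Y)}(x,y)=\sum_{w}x^{|w|}y^{\mathrm{des}(w)}$, the sum being over all Catalan words $w$ (of any length $|w|\ge 0$) avoiding $(X,Y)$, one sets $D_{(X,Y)}(x)=\left.\frac{\partial C_{(X,Y)}(x,y)}{\partial y}\right|_{y=1}=\sum_w \mathrm{des}(w)\,x^{|w|}$. Identities are between formal power series in $x$ (after clearing denominators); the square root of a power series with constant term $1$ is the one with constant term $1$. -}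

module Defs where

open import Data.Bool.Base using (if_then_else_)
open import Data.Fin.Base using (toℕ)
open import Data.Integer.Base as ℤ using (ℤ; +_; 0ℤ; 1ℤ)
import Data.Integer.Properties as ℤₚ
open import Data.List.Base using (List; []; _∷_; [_]; map; concatMap; filter; upTo; length)
import Data.List.Properties as List
open import Data.List.Membership.Propositional using (_∈_; find; lose)
open import Data.List.Membership.Propositional.Properties
  using (∈-map⁺; ∈-map⁻; ∈-concatMap⁺; ∈-concatMap⁻; ∈-upTo⁺; ∈-upTo⁻)
open import Data.List.Relation.Binary.Disjoint.Propositional using (Disjoint)
import Data.List.Relation.Unary.All as All
import Data.List.Relation.Unary.All.Properties as All
open import Data.List.Relation.Unary.AllPairs as AllPairs using ([]; _∷_)
import Data.List.Relation.Unary.AllPairs.Properties as AllPairs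
open import Data.List.Relation.Unary.Any using (here)
open import Data.List.Relation.Unary.Linked using (Linked; [-]; _∷_)
open import Data.List.Relation.Unary.Unique.Propositional using (Unique)
import Data.List.Relation.Unary.Unique.Propositional.Properties as Unique
open import Data.Nat.Base using (ℕ; zero; suc; _+_; _∸_; _≤_; s≤s; s≤s⁻¹)
open import Data.Nat.ListAction using (sum)
open import Data.Nat.Properties using (_>?_)
open import Data.Product.Base using (_×_; _,_)
open import Function.Bundles using (_⇔_; mk⇔)
open import Level using (0ℓ)
open import Relation.Binary.Core using (Rel)
open import Relation.Binary.Definitions using (Decidable)
open import Relation.Binary.PropositionalEquality
  using (_≡_; _≢_; _≗_; refl; cong)
open import Relation.Nullary using (¬_; Dec; does; no)
open import Relation.Nullary.Decidable using (¬?; map′; _×-dec_; _⊎-dec_)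
open import Data.Sum.Base using (_⊎_; inj₁; inj₂)

import Algebra.Properties.Semiring.Sum ℤₚ.+-*-semiring as ℤΣ

Word : Set
Word = List ℕ

Step : Rel ℕ 0ℓ
Step a b = b ≤ suc a

data IsCatalan : Word → Set where
  empty    : IsCatalan []
  nonEmpty : ∀ {w} → Linked Step (0 ∷ w) → IsCatalan (0 ∷ w)

-- All words of length n that may follow a letter a in a Catalan word.
continuations : ℕ → ℕ → List Word
continuations a zero    = [ [] ]
continuations a (suc n) =
  concatMap (λ b → map (b ∷_) (continuations b n)) (upTo (2 + a))

catalanWords : ℕ → List Word
catalanWords zero    = [ [] ]
catalanWords (suc n) = map (0 ∷_) (continuations 0 n)

des : Word → ℕ
des []          = 0
des (a ∷ [])    = 0
des (a ∷ b ∷ w) = (if does (a >? b) then 1 else 0) + des (b ∷ w)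

data Contains (X Y : Rel ℕ 0ℓ) : Word → Set where
  here  : ∀ {a b c w} → X a b → Y b c → Contains X Y (a ∷ b ∷ c ∷ w)
  there : ∀ {a w} → Contains X Y w → Contains X Y (a ∷ w)

Avoids : (X Y : Rel ℕ 0ℓ) → Word → Set
Avoids X Y w = ¬ Contains X Y w

module _ {X Y : Rel ℕ 0ℓ} (X? : Decidable X) (Y? : Decidable Y) where

  contains? : ∀ w → Dec (Contains X Y w)
  contains? []              = no λ ()
  contains? (a ∷ [])        = no λ { (there ()) }
  contains? (a ∷ b ∷ [])    = no λ { (there (there ())) }
  contains? (a ∷ b ∷ c ∷ w) =
    map′ to from ((X? a b ×-dec Y? b c) ⊎-dec contains? (b ∷ c ∷ w))
    where
    to : (X a b × Y b c) ⊎ Contains X Y (b ∷ c ∷ w) → Contains X Y (a ∷ b ∷ c ∷ w)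
    to (inj₁ (x , y)) = here x y
    to (inj₂ p)       = there p

    from : Contains X Y (a ∷ b ∷ c ∷ w) → (X a b × Y b c) ⊎ Contains X Y (b ∷ c ∷ w)
    from (here x y) = inj₁ (x , y)
    from (there p)  = inj₂ p

  avoids? : ∀ w → Dec (Avoids X Y w)
  avoids? w = ¬? (contains? w)

  totalDescents : ℕ → ℕ
  totalDescents n = sum (map des (filter avoids? (catalanWords n)))

-- Formal power series in x over ℤ, as coefficient sequences.
PowerSeries : Set
PowerSeries = ℕ → ℤ

infix  4 _≈_
infixl 6 _⊖_
infixl 7 _⊛_

_≈_ : Rel PowerSeries 0ℓ
f ≈ g = f ≗ g

_⊖_ : PowerSeries → PowerSeries → PowerSeries
(f ⊖ g) n = f n ℤ.- g n

_⊛_ : PowerSeries → PowerSeries → PowerSeries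
(f ⊛ g) n = ℤΣ.sum {suc n} λ i → f (toℕ i) ℤ.* g (n ∸ toℕ i)

-- Coefficients are listed in increasing order of degree.
polynomial : List ℤ → PowerSeries
polynomial []       _       = 0ℤ
polynomial (c ∷ cs) zero    = c
polynomial (c ∷ cs) (suc n) = polynomial cs n

-- There is at most one such s, since ℤ⟦x⟧ is a domain and s(0) = 1.
_IsSquareRootOf_ : PowerSeries → PowerSeries → Set
s IsSquareRootOf f = s 0 ≡ 1ℤ × s ⊛ s ≈ f

D : {X Y : Rel ℕ 0ℓ} → Decidable X → Decidable Y → PowerSeries
D X? Y? n = + totalDescents X? Y? n

private
  ∈-continuations⁺ : ∀ a w → Linked Step (a ∷ w) → w ∈ continuations a (length w)
  ∈-continuations⁺ a []      _       = here refl
  ∈-continuations⁺ a (b ∷ w) (p ∷ l) =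
    ∈-concatMap⁺ (λ b → map (b ∷_) (continuations b (length w)))
      (lose (∈-upTo⁺ (s≤s p)) (∈-map⁺ (b ∷_) (∈-continuations⁺ b w l)))

  ∈-continuations⁻ : ∀ a n {w} → w ∈ continuations a n → Linked Step (a ∷ w) × length w ≡ n
  ∈-continuations⁻ a zero    (here refl) = [-] , refl
  ∈-continuations⁻ a (suc n) w∈
    with find (∈-concatMap⁻ (λ b → map (b ∷_) (continuations b n)) {xs = upTo (2 + a)} w∈)
  ... | b , b∈ , w∈′ with ∈-map⁻ (b ∷_) w∈′
  ... | v , v∈ , refl with ∈-continuations⁻ b n v∈
  ... | l , e = s≤s⁻¹ (∈-upTo⁻ b∈) ∷ l , cong suc e

  continuations-unique : ∀ a n → Unique (continuations a n)
  continuations-unique a zero    = All.[] ∷ []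
  continuations-unique a (suc n) = Unique.concat⁺
    (All.map⁺ (All.universal (λ b → Unique.map⁺ List.∷-injectiveʳ (continuations-unique b n)) _))
    (AllPairs.map⁺ (AllPairs.map disjoint (Unique.upTo⁺ (2 + a))))
    where
    disjoint : ∀ {b c} → b ≢ c →
               Disjoint (map (b ∷_) (continuations b n)) (map (c ∷_) (continuations c n))
    disjoint {b} {c} b≢c (p , q) with ∈-map⁻ (b ∷_) p | ∈-map⁻ (c ∷_) q
    ... | _ , _ , refl | _ , _ , e = b≢c (List.∷-injectiveˡ e)

∈-catalanWords⇔ : ∀ n w → w ∈ catalanWords n ⇔ (IsCatalan w × length w ≡ n)
∈-catalanWords⇔ n w = mk⇔ (to n) (from n)
  where
  to : ∀ n {w} → w ∈ catalanWords n → IsCatalan w × length w ≡ n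
  to zero    (here refl) = empty , refl
  to (suc n) w∈ with ∈-map⁻ (0 ∷_) w∈
  ... | v , v∈ , refl with ∈-continuations⁻ 0 n v∈
  ... | l , e = nonEmpty l , cong suc e

  from : ∀ n {w} → IsCatalan w × length w ≡ n → w ∈ catalanWords n
  from _ (empty              , refl) = here refl
  from _ (nonEmpty {w = v} l , refl) = ∈-map⁺ (0 ∷_) (∈-continuations⁺ 0 v l)

catalanWords-unique : ∀ n → Unique (catalanWords n)
catalanWords-unique zero    = All.[] ∷ []
catalanWords-unique (suc n) = Unique.map⁺ List.∷-injectiveʳ (continuations-unique 0 n)

{-# OPTIONS --safe #-}
module Submission where

-- Let N_a and M_a be the series counting the avoiding words that start with a
-- letter a, and the descents in them, and put T_a = 1 + Σ_{b<a} N_b and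
-- U_a = Σ_{b<a} (N_b + M_b). Looking at the second letter,
-- N_a = x (T_a + x T_a + N_{a+1}) and M_a = x (U_a + x U_a + M_{a+1}): after a
-- repeated letter the word must end or descend. The word splits where it first
-- goes below a, so with c = N_0 and d = M_0 one expects N_a = c T_a and
-- M_a = d T_a + c U_a; the difference of the two sides satisfies a homogeneous
-- linear system with a factor x on the right, hence is zero. At a = 0 this gives
-- c = x (1 + x + c + c²) and d = x (d (1 + c) + c (c + d)); the discriminant of
-- the quadratic is 1 - 2x - 3x² - 4x³, with square root 1 - x - 2xc.

open import Defs
open import Algebra.Bundles using (CommutativeRing)
import Algebra.Solver.Ring
open import Algebra.Solver.Ring.AlmostCommutativeRing
  using (fromCommutativeRing; _-Raw-AlmostCommutative⟶_)
open import Data.Bool.Base using (true; false; if_then_else_)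
open import Data.Fin.Base using (Fin; toℕ)
open import Data.Integer.Base as ℤ using (ℤ; +_; -_; 0ℤ; 1ℤ)
import Data.Integer.Properties as ℤₚ
open import Data.Integer.Tactic.RingSolver using (solve-∀)
open import Data.List.Base using (List; []; _∷_; _∷ʳ_; _++_; map; concatMap; filter; upTo)
open import Data.List.Properties using (map-++; map-∘; map-cong; upTo-∷ʳ)
open import Data.Maybe.Base as Maybe using ()
open import Data.Nat.Base as ℕ using (ℕ; zero; suc; _∸_; _≤_; _<_; s≤s)
open import Data.Nat.ListAction using (sum)
open import Data.Nat.ListAction.Properties using (sum-++)
import Data.Nat.Properties as ℕₚ
open import Data.Nat.Properties using (_≟_; _≤?_; _>?_)
open import Data.Product.Base using (_×_; _,_; ∃-syntax)
open import Data.Sum.Base using (inj₁; inj₂)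
open import Function.Base using (_∘_; const)
open import Level using (0ℓ)
open import Relation.Binary.PropositionalEquality
  using (_≡_; _≢_; refl; sym; trans; cong; cong₂; module ≡-Reasoning)
open import Relation.Nullary using (does; contradiction)
open import Relation.Nullary.Decidable using (dec⇒maybe; dec-true; dec-false)
open import Relation.Unary using (Pred; Decidable)

import Algebra.Properties.Semiring.Sum ℤₚ.+-*-semiring as ℤΣ

-- The ring of formal power series

infixl 6 _⊕_
infix  8 ⊝_

_⊕_ : PowerSeries → PowerSeries → PowerSeries
(f ⊕ g) n = f n ℤ.+ g n

⊝_ : PowerSeries → PowerSeries
(⊝ f) n = - f n

constant : ℤ → PowerSeries
constant c = polynomial (c ∷ [])

𝟎 𝟏 X : PowerSeries
𝟎 = constant 0ℤ
𝟏 = constant 1ℤ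
X = polynomial (0ℤ ∷ 1ℤ ∷ [])

tail : PowerSeries → PowerSeries
tail f n = f (suc n)

⊛-cong : ∀ {f f′ g g′} → f ≈ f′ → g ≈ g′ → f ⊛ g ≈ f′ ⊛ g′
⊛-cong f≈f′ g≈g′ n = ℤΣ.sum-cong-≗ {suc n} λ i → cong₂ ℤ._*_ (f≈f′ (toℕ i)) (g≈g′ (n ∸ toℕ i))

⊛-zero : ∀ f g → (f ⊛ g) 0 ≡ f 0 ℤ.* g 0
⊛-zero f g = ℤₚ.+-identityʳ _

-- `⊛` unfolds by the lowest coefficient of its left factor. Peeling off the opposite end of the sum
-- turns commutativity into an induction on the degree.
⊛-sucʳ : ∀ f g n → (f ⊛ g) (suc n) ≡ f (suc n) ℤ.* g 0 ℤ.+ (f ⊛ tail g) n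
⊛-sucʳ f g zero    = lemma (f 0) (f 1) (g 0) (g 1)
  where
  lemma : ∀ a a′ b b′ → a ℤ.* b′ ℤ.+ (a′ ℤ.* b ℤ.+ 0ℤ) ≡ a′ ℤ.* b ℤ.+ (a ℤ.* b′ ℤ.+ 0ℤ)
  lemma = solve-∀
⊛-sucʳ f g (suc n) = trans
  (cong (ℤ._+_ (f 0 ℤ.* g (suc (suc n)))) (⊛-sucʳ (tail f) g n))
  (lemma (f 0 ℤ.* g (suc (suc n))) (f (suc (suc n)) ℤ.* g 0) ((tail f ⊛ tail g) n))
  where
  lemma : ∀ a b c → a ℤ.+ (b ℤ.+ c) ≡ b ℤ.+ (a ℤ.+ c)
  lemma = solve-∀

⊛-comm : ∀ f g → f ⊛ g ≈ g ⊛ f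
⊛-comm f g zero    = cong (ℤ._+ 0ℤ) (ℤₚ.*-comm (f 0) (g 0))
⊛-comm f g (suc n) = trans
  (cong₂ ℤ._+_ (ℤₚ.*-comm (f 0) (g (suc n))) (⊛-comm (tail f) g n))
  (sym (⊛-sucʳ g f n))

⊛-distribʳ : ∀ h f g → (f ⊕ g) ⊛ h ≈ f ⊛ h ⊕ g ⊛ h
⊛-distribʳ h f g n = trans
  (ℤΣ.sum-cong-≗ {suc n} λ i → ℤₚ.*-distribʳ-+ (h (n ∸ toℕ i)) (f (toℕ i)) (g (toℕ i)))
  (ℤΣ.∑-distrib-+ {suc n} (term f) (term g))
  where
  term : PowerSeries → Fin (suc n) → ℤ
  term f i = f (toℕ i) ℤ.* h (n ∸ toℕ i)

scale-⊛ : ∀ c f g n → ((λ m → c ℤ.* f m) ⊛ g) n ≡ c ℤ.* (f ⊛ g) n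
scale-⊛ c f g n = trans
  (ℤΣ.sum-cong-≗ {suc n} λ i → ℤₚ.*-assoc c (f (toℕ i)) (g (n ∸ toℕ i)))
  (sym (ℤΣ.*-distribˡ-sum {suc n} c λ i → f (toℕ i) ℤ.* g (n ∸ toℕ i)))

⊛-assoc : ∀ f g h → (f ⊛ g) ⊛ h ≈ f ⊛ (g ⊛ h)
⊛-assoc f g h zero    = lemma (f 0) (g 0) (h 0)
  where
  lemma : ∀ a b c → (a ℤ.* b ℤ.+ 0ℤ) ℤ.* c ℤ.+ 0ℤ ≡ a ℤ.* (b ℤ.* c ℤ.+ 0ℤ) ℤ.+ 0ℤ
  lemma = solve-∀
⊛-assoc f g h (suc n) = begin
  -- By computation the tail of `f ⊛ g` is `f 0` times `tail g` plus `tail f ⊛ g`; distributivity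
  -- then exposes an instance of lower degree.
  (f 0 ℤ.* g 0 ℤ.+ 0ℤ) ℤ.* h (suc n) ℤ.+ (((λ m → f 0 ℤ.* g (suc m)) ⊕ tail f ⊛ g) ⊛ h) n
    ≡⟨ cong (ℤ._+_ ((f 0 ℤ.* g 0 ℤ.+ 0ℤ) ℤ.* h (suc n)))
         (trans (⊛-distribʳ h (λ m → f 0 ℤ.* g (suc m)) (tail f ⊛ g) n)
                (cong₂ ℤ._+_ (scale-⊛ (f 0) (tail g) h n) (⊛-assoc (tail f) g h n))) ⟩
  (f 0 ℤ.* g 0 ℤ.+ 0ℤ) ℤ.* h (suc n) ℤ.+ (f 0 ℤ.* (tail g ⊛ h) n ℤ.+ (tail f ⊛ (g ⊛ h)) n)
    ≡⟨ lemma (f 0) (g 0) (h (suc n)) ((tail g ⊛ h) n) _ ⟩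
  f 0 ℤ.* (g 0 ℤ.* h (suc n) ℤ.+ (tail g ⊛ h) n) ℤ.+ (tail f ⊛ (g ⊛ h)) n ∎
  where
  open ≡-Reasoning
  lemma : ∀ a b c d e → (a ℤ.* b ℤ.+ 0ℤ) ℤ.* c ℤ.+ (a ℤ.* d ℤ.+ e) ≡ a ℤ.* (b ℤ.* c ℤ.+ d) ℤ.+ e
  lemma = solve-∀

⊛-vanishes : ∀ u {f} n → (∀ {k} → k ≤ n → f k ≡ 0ℤ) → (u ⊛ f) n ≡ 0ℤ
⊛-vanishes u n f≡0 = trans
  (ℤΣ.sum-cong-≗ {suc n} λ i →
    trans (cong (ℤ._*_ (u (toℕ i))) (f≡0 (ℕₚ.m∸n≤m n (toℕ i)))) (ℤₚ.*-zeroʳ (u (toℕ i))))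
  (ℤΣ.sum-replicate-zero (suc n))

constant-⊛ : ∀ c f n → (constant c ⊛ f) n ≡ c ℤ.* f n
constant-⊛ c f zero    = ⊛-zero (constant c) f
constant-⊛ c f (suc n) = trans
  (cong (ℤ._+_ (c ℤ.* f (suc n))) (trans (⊛-comm (λ _ → 0ℤ) f n) (⊛-vanishes f n λ _ → refl)))
  (ℤₚ.+-identityʳ _)

⊛-identityˡ : ∀ f → 𝟏 ⊛ f ≈ f
⊛-identityˡ f n = trans (constant-⊛ 1ℤ f n) (ℤₚ.*-identityˡ (f n))

𝟎-vanishes : 𝟎 ≈ λ _ → 0ℤ
𝟎-vanishes zero    = refl
𝟎-vanishes (suc n) = refl

powerSeriesRing : CommutativeRing 0ℓ 0ℓ
powerSeriesRing = record
  { Carrier = PowerSeries ; _≈_ = _≈_ ; _+_ = _⊕_ ; _*_ = _⊛_ ; -_ = ⊝_ ; 0# = 𝟎 ; 1# = 𝟏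
  ; isCommutativeRing = record
    { isRing = record
      { +-isAbelianGroup = record
        { isGroup = record
          { isMonoid = record
            { isSemigroup = record
              { isMagma = record
                { isEquivalence = record
                  { refl  = λ _ → refl
                  ; sym   = λ p n → sym (p n)
                  ; trans = λ p q n → trans (p n) (q n)
                  }
                ; ∙-cong = λ p q n → cong₂ ℤ._+_ (p n) (q n)
                }
              ; assoc = λ f g h n → ℤₚ.+-assoc (f n) (g n) (h n)
              }
            ; identity =
                (λ f n → trans (cong (ℤ._+ f n) (𝟎-vanishes n)) (ℤₚ.+-identityˡ (f n))) ,
                (λ f n → trans (cong (ℤ._+_ (f n)) (𝟎-vanishes n)) (ℤₚ.+-identityʳ (f n)))
            }
          ; inverse =
              (λ f n → trans (ℤₚ.+-inverseˡ (f n)) (sym (𝟎-vanishes n))) ,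
              (λ f n → trans (ℤₚ.+-inverseʳ (f n)) (sym (𝟎-vanishes n)))
          ; ⁻¹-cong = λ p n → cong -_ (p n)
          }
        ; comm = λ f g n → ℤₚ.+-comm (f n) (g n)
        }
      ; *-cong = ⊛-cong
      ; *-assoc = ⊛-assoc
      ; *-identity = ⊛-identityˡ , λ f n → trans (⊛-comm f 𝟏 n) (⊛-identityˡ f n)
      ; distrib =
          (λ h f g n → trans (⊛-comm h (f ⊕ g) n) (trans (⊛-distribʳ h f g n)
             (cong₂ ℤ._+_ (⊛-comm f h n) (⊛-comm g h n)))) ,
          ⊛-distribʳ
      }
    ; *-comm = ⊛-comm
    }
  }

open CommutativeRing powerSeriesRing using ()
  renaming (refl to ≈-refl; sym to ≈-sym; trans to ≈-trans; +-cong to ⊕-cong)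

-- The solver needs coefficients whose equality can be tested. Series do not offer this, so the
-- integers are embedded as constant series.
constant-morphism :
  CommutativeRing.rawRing ℤₚ.+-*-commutativeRing
    -Raw-AlmostCommutative⟶ fromCommutativeRing powerSeriesRing
constant-morphism = record
  { ⟦_⟧    = constant
  ; +-homo = λ { _ _ zero → refl ; _ _ (suc n) → refl }
  ; *-homo = *-homo
  ; -‿homo = λ { _ zero → refl ; _ (suc n) → refl }
  ; 0-homo = λ _ → refl
  ; 1-homo = λ _ → refl
  }
  where
  *-homo : ∀ a b → constant (a ℤ.* b) ≈ constant a ⊛ constant b
  *-homo a b zero    = sym (constant-⊛ a (constant b) 0)
  *-homo a b (suc n) = sym (trans (constant-⊛ a (constant b) (suc n)) (ℤₚ.*-zeroʳ a))

open Algebra.Solver.Ring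
  (CommutativeRing.rawRing ℤₚ.+-*-commutativeRing)
  (fromCommutativeRing powerSeriesRing)
  constant-morphism
  (λ a b → Maybe.map (λ a≡b n → cong (λ c → constant c n) a≡b) (dec⇒maybe (a ℤₚ.≟ b)))
  using (solve; _:=_; _:+_; _:*_; _:-_; :-_; con)

X⊛-suc : ∀ f n → (X ⊛ f) (suc n) ≡ f n
X⊛-suc f n = trans (ℤₚ.+-identityˡ _) (⊛-identityˡ f n)

-- Because of the factor `X`, coefficient `k + 1` of `E a` depends only on coefficients up to `k` of
-- the family. The induction on the degree treats all `a` together, since `step` passes from `a` to
-- `suc a` and to `1`.
contraction-vanishes : ∀ (E v : ℕ → PowerSeries) u →
  (∀ a → E a ≈ X ⊛ (E (suc a) ⊕ u ⊛ E a ⊕ v a ⊛ E 1)) → ∀ a → E a ≈ 𝟎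
contraction-vanishes E v u step a n =
  trans (vanishes-below (suc n) a (ℕₚ.n<1+n n)) (sym (𝟎-vanishes n))
  where
  vanishes-below : ∀ n a {k} → k < n → E a k ≡ 0ℤ
  vanishes-below (suc n) a {zero}  _         = step a 0
  vanishes-below (suc n) a {suc k} (s≤s k<n) = trans (step a (suc k)) (trans
    (X⊛-suc (E (suc a) ⊕ u ⊛ E a ⊕ v a ⊛ E 1) k)
    (cong₂ ℤ._+_
      (cong₂ ℤ._+_ (vanishes-below n (suc a) k<n)
        (⊛-vanishes u k λ j≤k → vanishes-below n a (ℕₚ.≤-<-trans j≤k k<n)))
      (⊛-vanishes (v a) k λ j≤k → vanishes-below n 1 (ℕₚ.≤-<-trans j≤k k<n))))

-- An equation is derived from others by writing the difference of its sides as a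
-- linear combination of theirs, so that the solver never has to substitute.
infixl 6 _⊞_
_⊞_ : ∀ {e e′} → e ≈ 𝟎 → e′ ≈ 𝟎 → e ⊕ e′ ≈ 𝟎
_⊞_ {e} {e′} p q = ≈-trans (⊕-cong {e} {𝟎} {e′} {𝟎} p q) (λ { zero → refl ; (suc n) → refl })

multiple : ∀ u {p q} → p ≈ q → u ⊛ (p ⊖ q) ≈ 𝟎
multiple u {p} {q} p≈q n =
  trans (⊛-vanishes u n λ {k} _ → trans (cong (λ z → p k ℤ.- z) (sym (p≈q k))) (ℤₚ.+-inverseʳ (p k)))
        (sym (𝟎-vanishes n))

by-combination : ∀ {p q e} → p ⊖ q ≈ e → e ≈ 𝟎 → p ≈ q
by-combination {p} {q} p-q≈e e≈0 n =
  ℤₚ.i-j≡0⇒i≡j (p n) (q n) (trans (p-q≈e n) (trans (e≈0 n) (𝟎-vanishes n)))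


-- Cancellation and uniqueness of square roots

cancelˡ-vanishing : ∀ G F → G 0 ≢ 0ℤ → G ⊛ F ≈ 𝟎 → F ≈ 𝟎
cancelˡ-vanishing G F G₀≢0 GF≈0 n = trans (vanishes-below (suc n) (ℕₚ.n<1+n n)) (sym (𝟎-vanishes n))
  where
  cancel : ∀ {i} → G 0 ℤ.* i ≡ 0ℤ → i ≡ 0ℤ
  cancel {i} eq with ℤₚ.i*j≡0⇒i≡0∨j≡0 (G 0) eq
  ... | inj₁ G₀≡0 = contradiction G₀≡0 G₀≢0
  ... | inj₂ i≡0  = i≡0

  vanishes-below : ∀ n {k} → k < n → F k ≡ 0ℤ
  vanishes-below (suc n) {zero}  _         = cancel (trans (sym (⊛-zero G F)) (GF≈0 0))
  -- The other terms of this coefficient of `G ⊛ F` contain lower coefficients of `F`, which are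
  -- already zero.
  vanishes-below (suc n) {suc k} (s≤s k<n) = cancel (begin
    G 0 ℤ.* F (suc k)                            ≡⟨ ℤₚ.+-identityʳ _ ⟨
    G 0 ℤ.* F (suc k) ℤ.+ 0ℤ                     ≡⟨ cong (ℤ._+_ (G 0 ℤ.* F (suc k)))
                                                      (⊛-vanishes (tail G) k λ j≤k →
                                                        vanishes-below n (ℕₚ.≤-<-trans j≤k k<n)) ⟨
    (G ⊛ F) (suc k)                              ≡⟨ GF≈0 (suc k) ⟩
    0ℤ                                           ∎)
    where open ≡-Reasoning

-- In `(r + s)(r - s) = 0` the first factor has constant term 2 and can be cancelled.
squareRoot-unique : ∀ f r s → r IsSquareRootOf f → s IsSquareRootOf f → r ≈ s
squareRoot-unique f r s (r₀≡1 , rr≈f) (s₀≡1 , ss≈f) = by-combination {r} {s} ≈-refl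
  (cancelˡ-vanishing (r ⊕ s) (r ⊖ s) r₀+s₀≢0 (≈-trans
    (solve 2 (λ r s → (r :+ s) :* (r :- s) := con 1ℤ :* (r :* r :- s :* s)) ≈-refl r s)
    (multiple 𝟏 {r ⊛ r} {s ⊛ s} (≈-trans rr≈f (≈-sym ss≈f)))))
  where
  r₀+s₀≢0 : r 0 ℤ.+ s 0 ≢ 0ℤ
  r₀+s₀≢0 eq rewrite r₀≡1 | s₀≡1 with () ← eq

-- Built from ring operations, so that the solver can read a polynomial as an expression in `X`.
horner : List ℤ → PowerSeries
horner []       = 𝟎
horner (c ∷ cs) = constant c ⊕ X ⊛ horner cs

polynomial≈horner : ∀ cs → polynomial cs ≈ horner cs
polynomial≈horner []       n       = sym (𝟎-vanishes n)
polynomial≈horner (c ∷ cs) zero    = sym (ℤₚ.+-identityʳ c)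
polynomial≈horner (c ∷ cs) (suc n) =
  sym (trans (ℤₚ.+-identityˡ _) (trans (X⊛-suc (horner cs) n) (sym (polynomial≈horner cs n))))

-- Words sorted by their first letter

Weight : Set
Weight = Word → ℕ

-- Weight zero replaces filtering: sums over all continuations can then be compared word by word,
-- with a prefix absorbed into the weight.
avoidingOnly : Weight → Weight
avoidingOnly g w = if does (avoids? _≟_ _≤?_ w) then g w else 0

avoidingOnly-cong : ∀ g g′ w → g w ≡ g′ w → avoidingOnly g w ≡ avoidingOnly g′ w
avoidingOnly-cong g g′ w = cong λ x → if does (avoids? _≟_ _≤?_ w) then x else 0

-- An occurrence at the front would need two equal letters. The case split is there because
-- `contains?` reduces only once it sees whether a third letter exists.
avoidingOnly-≢ : ∀ g {a b} v → a ≢ b → avoidingOnly g (a ∷ b ∷ v) ≡ avoidingOnly (g ∘ (a ∷_)) (b ∷ v)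
avoidingOnly-≢ g         []      _   = refl
avoidingOnly-≢ g {a} {b} (c ∷ v) a≢b rewrite dec-false (a ≟ b) a≢b = refl

-- The drop to `c` rules out an occurrence at the first `a` by the second relation and one at the
-- second `a` by the first relation.
avoidingOnly-≡> : ∀ g {a c} v → c < a →
  avoidingOnly g (a ∷ a ∷ c ∷ v) ≡ avoidingOnly (g ∘ (a ∷_) ∘ (a ∷_)) (c ∷ v)
avoidingOnly-≡> g {a} {c} v c<a
  rewrite dec-true (a ≟ a) refl | dec-false (a ≤? c) (ℕₚ.<⇒≱ c<a) =
  avoidingOnly-≢ (g ∘ (a ∷_)) v (ℕₚ.>⇒≢ c<a)

avoidingOnly-≡≤ : ∀ g {a c} v → a ≤ c → avoidingOnly g (a ∷ a ∷ c ∷ v) ≡ 0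
avoidingOnly-≡≤ g {a} {c} v a≤c
  rewrite dec-true (a ≟ a) refl | dec-true (a ≤? c) a≤c = refl

-- Finite sums and the split by the second letter

Σ< : (ℕ → ℕ) → ℕ → ℕ
Σ< f zero    = 0
Σ< f (suc n) = Σ< f n ℕ.+ f n

Σ<-cong : ∀ {f g} n → (∀ {i} → i < n → f i ≡ g i) → Σ< f n ≡ Σ< g n
Σ<-cong zero    _   = refl
Σ<-cong (suc n) f≡g =
  cong₂ ℕ._+_ (Σ<-cong n λ i<n → f≡g (ℕₚ.m<n⇒m<1+n i<n)) (f≡g (ℕₚ.n<1+n n))

sum-upTo : ∀ f n → sum (map f (upTo n)) ≡ Σ< f n
sum-upTo f zero    = refl
sum-upTo f (suc n) = begin
  sum (map f (upTo (suc n)))              ≡⟨ cong (sum ∘ map f) (upTo-∷ʳ n) ⟨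
  sum (map f (upTo n ∷ʳ n))               ≡⟨ cong sum (map-++ f (upTo n) (n ∷ [])) ⟩
  sum (map f (upTo n) ∷ʳ f n)             ≡⟨ sum-++ (map f (upTo n)) (f n ∷ []) ⟩
  sum (map f (upTo n)) ℕ.+ (f n ℕ.+ 0)    ≡⟨ cong₂ ℕ._+_ (sum-upTo f n) (ℕₚ.+-identityʳ (f n)) ⟩
  Σ< f n ℕ.+ f n                          ∎
  where open ≡-Reasoning

sum-map-concatMap : ∀ {A B : Set} (f : B → ℕ) (F : A → List B) xs →
  sum (map f (concatMap F xs)) ≡ sum (map (λ x → sum (map f (F x))) xs)
sum-map-concatMap f F []       = refl
sum-map-concatMap f F (x ∷ xs) = begin
  sum (map f (F x ++ concatMap F xs))                  ≡⟨ cong sum (map-++ f (F x) _) ⟩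
  sum (map f (F x) ++ map f (concatMap F xs))          ≡⟨ sum-++ (map f (F x)) _ ⟩
  sum (map f (F x)) ℕ.+ sum (map f (concatMap F xs))
    ≡⟨ cong (sum (map f (F x)) ℕ.+_) (sum-map-concatMap f F xs) ⟩
  sum (map f (F x)) ℕ.+ sum (map (λ x → sum (map f (F x))) xs) ∎
  where open ≡-Reasoning

sum-map-+ : ∀ {A : Set} (f g : A → ℕ) xs →
  sum (map (λ x → f x ℕ.+ g x) xs) ≡ sum (map f xs) ℕ.+ sum (map g xs)
sum-map-+ f g []       = refl
sum-map-+ f g (x ∷ xs) = trans
  (cong ((f x ℕ.+ g x) ℕ.+_) (sum-map-+ f g xs))
  (interchange (f x) (g x) (sum (map f xs)) (sum (map g xs)))
  where open import Algebra.Properties.CommutativeSemigroup ℕₚ.+-commutativeSemigroup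

sum-map-filter : ∀ {A : Set} {P : Pred A 0ℓ} (P? : Decidable P) (f : A → ℕ) xs →
  sum (map f (filter P? xs)) ≡ sum (map (λ x → if does (P? x) then f x else 0) xs)
sum-map-filter P? f []       = refl
sum-map-filter P? f (x ∷ xs) with does (P? x)
... | true  = cong (f x ℕ.+_) (sum-map-filter P? f xs)
... | false = sum-map-filter P? f xs

total : Weight → ℕ → ℕ → ℕ
total h a n = sum (map (λ v → h (a ∷ v)) (continuations a n))

total-cong : ∀ h h′ a n → (∀ v → h (a ∷ v) ≡ h′ (a ∷ v)) → total h a n ≡ total h′ a n
total-cong h h′ a n h≡h′ = cong sum (map-cong h≡h′ (continuations a n))

total-zero : ∀ h a n → (∀ v → h (a ∷ v) ≡ 0) → total h a n ≡ 0
total-zero h a n h≡0 = trans (total-cong h (const 0) a n h≡0) (sum-zeros (continuations a n))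
  where
  sum-zeros : ∀ vs → sum (map (const 0) vs) ≡ 0
  sum-zeros []       = refl
  sum-zeros (_ ∷ vs) = sum-zeros vs

total-suc : ∀ h a n → total h a (suc n) ≡
  Σ< (λ b → total (h ∘ (a ∷_)) b n) a ℕ.+ total (h ∘ (a ∷_)) a n ℕ.+ total (h ∘ (a ∷_)) (suc a) n
total-suc h a n = begin
  total h a (suc n)
    ≡⟨ sum-map-concatMap (h ∘ (a ∷_)) (λ b → map (b ∷_) (continuations b n)) (upTo (2 ℕ.+ a)) ⟩
  sum (map (λ b → sum (map (h ∘ (a ∷_)) (map (b ∷_) (continuations b n)))) (upTo (2 ℕ.+ a)))
    ≡⟨ cong sum (map-cong (λ b → cong sum (sym (map-∘ (continuations b n)))) (upTo (2 ℕ.+ a))) ⟩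
  sum (map (λ b → total (h ∘ (a ∷_)) b n) (upTo (2 ℕ.+ a)))
    ≡⟨ sum-upTo (λ b → total (h ∘ (a ∷_)) b n) (2 ℕ.+ a) ⟩
  -- `Σ<` peels off its last term, so two unfoldings separate the letters `a` and `suc a` from those
  -- below `a`.
  Σ< (λ b → total (h ∘ (a ∷_)) b n) (2 ℕ.+ a) ∎
  where open ≡-Reasoning

-- The recurrence in the first letter

startingAt : Weight → ℕ → PowerSeries
startingAt g a zero    = 0ℤ
startingAt g a (suc n) = + total (avoidingOnly g) a n

accumulate : ℤ → (ℕ → PowerSeries) → ℕ → PowerSeries
accumulate e W zero    = constant e
accumulate e W (suc a) = accumulate e W a ⊕ W a

-- One argument serves both statistics: `g′` is the weight as seen from just behind a descent, and
-- `e` that of a single letter. Counting words takes `g = g′ = const 1` and `e = 1`; counting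
-- descents takes `g = des`, `g′ = suc ∘ des` and `e = 0`.
module _ {g g′ : Weight} {e : ℕ}
  (g-single  : ∀ a → g (a ∷ []) ≡ e)
  (g-ascend  : ∀ {a b} v → a ≤ b → g (a ∷ b ∷ v) ≡ g (b ∷ v))
  (g-descend : ∀ {a b} v → b < a → g (a ∷ b ∷ v) ≡ g′ (b ∷ v))
  where

  private
    A : ℕ → PowerSeries
    A = accumulate (+ e) (startingAt g′)

    A-zero : ∀ a → A a 0 ≡ + e
    A-zero zero    = refl
    A-zero (suc a) = trans (ℤₚ.+-identityʳ (A a 0)) (A-zero a)

    A-suc : ∀ a n → A a (suc n) ≡ + Σ< (λ b → total (avoidingOnly g′) b n) a
    A-suc zero    n = refl
    A-suc (suc a) n = cong (ℤ._+ (+ total (avoidingOnly g′) a n)) (A-suc a n)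

    lower : ∀ a n → Σ< (λ b → total (avoidingOnly g ∘ (a ∷_)) b n) a ≡
                    Σ< (λ b → total (avoidingOnly g′) b n) a
    lower a n = Σ<-cong a λ {b} b<a → total-cong (avoidingOnly g ∘ (a ∷_)) (avoidingOnly g′) b n λ v →
      trans (avoidingOnly-≢ g v (ℕₚ.>⇒≢ b<a)) (avoidingOnly-cong (g ∘ (a ∷_)) g′ (b ∷ v) (g-descend v b<a))

    higher : ∀ a n → total (avoidingOnly g ∘ (a ∷_)) (suc a) n ≡ total (avoidingOnly g) (suc a) n
    higher a n = total-cong (avoidingOnly g ∘ (a ∷_)) (avoidingOnly g) (suc a) n λ v →
      trans (avoidingOnly-≢ g v (ℕₚ.<⇒≢ (ℕₚ.n<1+n a)))
            (avoidingOnly-cong (g ∘ (a ∷_)) g (suc a ∷ v) (g-ascend v (ℕₚ.n≤1+n a)))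

    -- After `a a` the word either ends, which is the constant term `e` of `A a`, or drops below
    -- `a`; any other third letter completes the pattern.
    repeated : ∀ a n → + total (avoidingOnly g ∘ (a ∷_)) a n ≡ A a n
    repeated a zero    = trans
      (cong +_ (trans (ℕₚ.+-identityʳ _) (trans (g-ascend [] ℕₚ.≤-refl) (g-single a))))
      (sym (A-zero a))
    repeated a (suc n) = trans (cong +_ (begin
      total h a (suc n)
        ≡⟨ total-suc h a n ⟩
      Σ< (λ c → total (h ∘ (a ∷_)) c n) a ℕ.+ total (h ∘ (a ∷_)) a n ℕ.+ total (h ∘ (a ∷_)) (suc a) n
        ≡⟨ cong₂ ℕ._+_ (cong₂ ℕ._+_
             (Σ<-cong a λ {c} c<a → total-cong (h ∘ (a ∷_)) (avoidingOnly g′) c n λ v →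
               trans (avoidingOnly-≡> g v c<a) (avoidingOnly-cong (g ∘ (a ∷_) ∘ (a ∷_)) g′ (c ∷ v)
                 (trans (g-ascend (c ∷ v) ℕₚ.≤-refl) (g-descend v c<a))))
             (total-zero (h ∘ (a ∷_)) a n λ v → avoidingOnly-≡≤ g v ℕₚ.≤-refl))
             (total-zero (h ∘ (a ∷_)) (suc a) n λ v → avoidingOnly-≡≤ g v (ℕₚ.n≤1+n a)) ⟩
      Σ< (λ c → total (avoidingOnly g′) c n) a ℕ.+ 0 ℕ.+ 0
        ≡⟨ trans (ℕₚ.+-identityʳ _) (ℕₚ.+-identityʳ _) ⟩
      Σ< (λ c → total (avoidingOnly g′) c n) a ∎))
      (sym (A-suc a n))
      where
      open ≡-Reasoning
      h = avoidingOnly g ∘ (a ∷_)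

  -- `A a` accounts for ending after `a` or dropping below it, `X ⊛ A a` for repeating `a`, and the
  -- last summand for rising to `suc a`. Degree 1 is separate: the one-letter word has no second
  -- letter and comes from the constant term of `A a`.
  startingAt-recurrence : ∀ a →
    startingAt g a ≈ X ⊛ (A a ⊕ X ⊛ A a ⊕ startingAt g (suc a))
  startingAt-recurrence a zero          = refl
  startingAt-recurrence a (suc zero)    = sym (begin
    (X ⊛ (A a ⊕ X ⊛ A a ⊕ startingAt g (suc a))) 1  ≡⟨ X⊛-suc (A a ⊕ X ⊛ A a ⊕ startingAt g (suc a)) 0 ⟩
    A a 0 ℤ.+ 0ℤ ℤ.+ 0ℤ                              ≡⟨ trans (ℤₚ.+-identityʳ _) (ℤₚ.+-identityʳ _) ⟩
    A a 0                                            ≡⟨ A-zero a ⟩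
    + e                                              ≡⟨ cong +_ (g-single a) ⟨
    + g (a ∷ [])                                     ≡⟨ cong +_ (ℕₚ.+-identityʳ _) ⟨
    + (g (a ∷ []) ℕ.+ 0)                             ∎)
    where open ≡-Reasoning
  startingAt-recurrence a (suc (suc n)) = begin
    + total (avoidingOnly g) a (suc n)
      ≡⟨ cong +_ (total-suc (avoidingOnly g) a n) ⟩
    + (Σ< (λ b → total (avoidingOnly g ∘ (a ∷_)) b n) a ℕ.+ total (avoidingOnly g ∘ (a ∷_)) a n
         ℕ.+ total (avoidingOnly g ∘ (a ∷_)) (suc a) n)
      ≡⟨ cong₂ ℤ._+_ (cong₂ ℤ._+_
           (trans (cong +_ (lower a n)) (sym (A-suc a n)))
           (trans (repeated a n) (sym (X⊛-suc (A a) n))))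
           (cong +_ (higher a n)) ⟩
    A a (suc n) ℤ.+ (X ⊛ A a) (suc n) ℤ.+ startingAt g (suc a) (suc n)
      ≡⟨ X⊛-suc (A a ⊕ X ⊛ A a ⊕ startingAt g (suc a)) (suc n) ⟨
    (X ⊛ (A a ⊕ X ⊛ A a ⊕ startingAt g (suc a))) (suc (suc n)) ∎
    where open ≡-Reasoning

des-ascend : ∀ {a b} v → a ≤ b → des (a ∷ b ∷ v) ≡ des (b ∷ v)
des-ascend {a} {b} v a≤b rewrite dec-false (a >? b) (ℕₚ.≤⇒≯ a≤b) = refl

des-descend : ∀ {a b} v → b < a → des (a ∷ b ∷ v) ≡ suc (des (b ∷ v))
des-descend {a} {b} v b<a rewrite dec-true (a >? b) b<a = refl

-- The functional equations

N M K T U : ℕ → PowerSeries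
N = startingAt (const 1)
M = startingAt des
K = startingAt (suc ∘ des)
T = accumulate 1ℤ N
U = accumulate 0ℤ K

-- The weight `suc ∘ des` of `K` counts the drop into the word together with the descents inside it.
K≈N+M : ∀ a → K a ≈ N a ⊕ M a
K≈N+M a zero    = refl
K≈N+M a (suc n) = cong +_ (trans
  (total-cong (avoidingOnly (suc ∘ des)) (λ w → avoidingOnly (const 1) w ℕ.+ avoidingOnly des w) a n
    λ v → avoidingOnly-suc (a ∷ v))
  (sum-map-+ (λ v → avoidingOnly (const 1) (a ∷ v)) (λ v → avoidingOnly des (a ∷ v)) (continuations a n)))
  where
  avoidingOnly-suc : ∀ w → avoidingOnly (suc ∘ des) w ≡ avoidingOnly (const 1) w ℕ.+ avoidingOnly des w
  avoidingOnly-suc w with does (avoids? _≟_ _≤?_ w)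
  ... | true  = refl
  ... | false = refl

N-recurrence : ∀ a → N a ≈ X ⊛ (T a ⊕ X ⊛ T a ⊕ N (suc a))
N-recurrence = startingAt-recurrence (λ _ → refl) (λ _ _ → refl) (λ _ _ → refl)

M-recurrence : ∀ a → M a ≈ X ⊛ (U a ⊕ X ⊛ U a ⊕ M (suc a))
M-recurrence = startingAt-recurrence (λ _ → refl) des-ascend des-descend

D≈M₀ : D _≟_ _≤?_ ≈ M 0
D≈M₀ zero    = refl
D≈M₀ (suc n) = cong +_ (trans
  (sum-map-filter (avoids? _≟_ _≤?_) des (catalanWords (suc n)))
  (cong sum (sym (map-∘ (continuations 0 n)))))

c d : PowerSeries
c = N 0
d = M 0

N≈cT : ∀ a → N a ≈ c ⊛ T a
N≈cT a = by-combination {N a} {c ⊛ T a} ≈-refl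
  (contraction-vanishes (λ a → N a ⊖ c ⊛ T a) (λ a → ⊝ T a) c step a)
  where
  step : ∀ a → N a ⊖ c ⊛ T a ≈
    X ⊛ ((N (suc a) ⊖ c ⊛ T (suc a)) ⊕ c ⊛ (N a ⊖ c ⊛ T a) ⊕ (⊝ T a) ⊛ (N 1 ⊖ c ⊛ T 1))
  -- Subtracting `T a` times the recurrence at 0 leaves `X (N (suc a) - T a N 1)`. Inserting the two
  -- differences at `suc a` and `1` leaves `c (N a - c T a)` over.
  step a = by-combination
    (solve 6 (λ X c N₁ N N′ T →
        (N :- c :* T)
          :- X :* ((N′ :- c :* (T :+ N)) :+ c :* (N :- c :* T) :+ (:- T) :* (N₁ :- c :* (con 1ℤ :+ c)))
      := con 1ℤ :* (N :- X :* (T :+ X :* T :+ N′))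
          :+ (:- T) :* (c :- X :* (con 1ℤ :+ X :* con 1ℤ :+ N₁)))
      ≈-refl X c (N 1) (N a) (N (suc a)) (T a))
    (multiple 𝟏 (N-recurrence a) ⊞ multiple (⊝ T a) (N-recurrence 0))

-- As `T 1` is `𝟏 ⊕ c`, the factorisation at `a = 1` gives `N 1 = c (1 + c)`, which closes the
-- recurrence at 0.
c-equation : c ≈ X ⊛ (𝟏 ⊕ X ⊕ c ⊛ (𝟏 ⊕ c))
c-equation = by-combination
  (solve 3 (λ X c N₁ →
      c :- X :* (con 1ℤ :+ X :+ c :* (con 1ℤ :+ c))
    := con 1ℤ :* (c :- X :* (con 1ℤ :+ X :* con 1ℤ :+ N₁)) :+ X :* (N₁ :- c :* (con 1ℤ :+ c)))
    ≈-refl X c (N 1))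
  (multiple 𝟏 (N-recurrence 0) ⊞ multiple X (N≈cT 1))

-- Descents before the first drop below `a` contribute `d T_a`; that drop and the descents after it
-- contribute `c U_a`.
M≈dT+cU : ∀ a → M a ≈ d ⊛ T a ⊕ c ⊛ U a
M≈dT+cU a = by-combination {M a} {d ⊛ T a ⊕ c ⊛ U a} ≈-refl
  (contraction-vanishes F (λ a → ⊝ T a) c step a)
  where
  F : ℕ → PowerSeries
  F a = M a ⊖ (d ⊛ T a ⊕ c ⊛ U a)

  step : ∀ a → F a ≈ X ⊛ (F (suc a) ⊕ c ⊛ F a ⊕ (⊝ T a) ⊛ F 1)
  -- The recurrence at 0 and `c-equation`, multiplied by `T a` and `U a`, remove the terms without a
  -- difference `F`. The leftover `d N_a + c K_a` is reduced by `N≈cT` and `K≈N+M`, and what remains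
  -- is `c F_a`.
  step a = by-combination
    (solve 11 (λ X c d M₁ K₀ M M′ N K T U →
        let F = M :- (d :* T :+ c :* U) in
        F :- X :* ((M′ :- (d :* (T :+ N) :+ c :* (U :+ K))) :+ c :* F
                    :+ (:- T) :* (M₁ :- (d :* (con 1ℤ :+ c) :+ c :* (con 0ℤ :+ K₀))))
      := con 1ℤ :* (M :- X :* (U :+ X :* U :+ M′))
          :+ (:- T) :* (d :- X :* (con 0ℤ :+ X :* con 0ℤ :+ M₁))
          :+ (:- U) :* (c :- X :* (con 1ℤ :+ X :+ c :* (con 1ℤ :+ c)))
          :+ X :* (d :+ c) :* (N :- c :* T)
          :+ X :* c :* (K :- (N :+ M))
          :+ (:- (X :* T :* c)) :* (K₀ :- (c :+ d)))
      ≈-refl X c d (M 1) (K 0) (M a) (M (suc a)) (N a) (K a) (T a) (U a))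
    (multiple 𝟏 (M-recurrence a)
      ⊞ multiple (⊝ T a) (M-recurrence 0)
      ⊞ multiple (⊝ U a) c-equation
      ⊞ multiple (X ⊛ (d ⊕ c)) (N≈cT a)
      ⊞ multiple (X ⊛ c) (K≈N+M a)
      ⊞ multiple (⊝ (X ⊛ T a ⊛ c)) (K≈N+M 0))

d-equation : d ≈ X ⊛ (d ⊛ (𝟏 ⊕ c) ⊕ c ⊛ (c ⊕ d))
d-equation = by-combination
  (solve 5 (λ X c d M₁ K₀ →
      d :- X :* (d :* (con 1ℤ :+ c) :+ c :* (c :+ d))
    := con 1ℤ :* (d :- X :* (con 0ℤ :+ X :* con 0ℤ :+ M₁))
        :+ X :* (M₁ :- (d :* (con 1ℤ :+ c) :+ c :* (con 0ℤ :+ K₀)))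
        :+ X :* c :* (K₀ :- (c :+ d)))
    ≈-refl X c d (M 1) (K 0))
  (multiple 𝟏 (M-recurrence 0) ⊞ multiple X (M≈dT+cU 1) ⊞ multiple (X ⊛ c) (K≈N+M 0))

-- The square root of the discriminant and the closed form

√P : PowerSeries
√P = 𝟏 ⊖ X ⊖ constant (+ 2) ⊛ X ⊛ c

-- Completing the square in `X c² - (1 - X) c + X (1 + X) = 0` after multiplication by `4 X`, whence
-- the multiple of `c-equation`.
√P-isSquareRoot : √P IsSquareRootOf polynomial (+ 1 ∷ - + 2 ∷ - + 3 ∷ - + 4 ∷ [])
√P-isSquareRoot = refl , ≈-trans
  (by-combination
    (solve 2 (λ X c →
        let S = con 1ℤ :- X :- con (+ 2) :* X :* c in
        S :* S :- (con (+ 1) :+ X :* (con (- + 2) :+ X :* (con (- + 3) :+ X :* (con (- + 4) :+ X :* con 0ℤ))))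
      := (:- (con (+ 4) :* X)) :* (c :- X :* (con 1ℤ :+ X :+ c :* (con 1ℤ :+ c))))
      ≈-refl X c)
    (multiple (⊝ (constant (+ 4) ⊛ X)) c-equation))
  (≈-sym (polynomial≈horner (+ 1 ∷ - + 2 ∷ - + 3 ∷ - + 4 ∷ [])))

corollary3p6 : let P = polynomial (+ 1 ∷ - + 2 ∷ - + 3 ∷ - + 4 ∷ []) in
    (∃[ S ] S IsSquareRootOf P) ×
    (∀ S → S IsSquareRootOf P →
    (polynomial (+ 0 ∷ + 2 ∷ []) ⊛ S) ⊛ D {_≡_} {_≤_} _≟_ _≤?_
    ≈ polynomial (+ 1 ∷ - + 2 ∷ - + 1 ∷ - + 2 ∷ [])
    ⊖ polynomial (+ 1 ∷ - + 1 ∷ []) ⊛ S)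
corollary3p6 = (√P , √P-isSquareRoot) , λ S S²≈P →
  -- Any admissible `S` is `√P`, so the identity has to be verified only there.
  let S≈√P = squareRoot-unique _ S √P S²≈P √P-isSquareRoot
      2X = + 0 ∷ + 2 ∷ []
      L  = + 1 ∷ - + 1 ∷ []
      Q  = + 1 ∷ - + 2 ∷ - + 1 ∷ - + 2 ∷ []
  in ≈-trans (⊛-cong (⊛-cong (polynomial≈horner 2X) S≈√P) D≈M₀) (≈-trans main
       (λ n → cong₂ ℤ._-_ (sym (polynomial≈horner Q n))
                          (sym (⊛-cong (polynomial≈horner L) S≈√P n))))
  where
  -- `d-equation` amounts to `√P d = X c²`. By `c-equation`, `X c²` is `(1 - X) c - X - X²`, and
  -- `2 X c = 1 - X - √P` removes `c` after multiplication by `2 X`.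
  main : (horner (+ 0 ∷ + 2 ∷ []) ⊛ √P) ⊛ d ≈
         horner (+ 1 ∷ - + 2 ∷ - + 1 ∷ - + 2 ∷ []) ⊖ horner (+ 1 ∷ - + 1 ∷ []) ⊛ √P
  main = by-combination
    (solve 3 (λ X c d →
        let S = con 1ℤ :- X :- con (+ 2) :* X :* c in
        ((con (+ 0) :+ X :* (con (+ 2) :+ X :* con 0ℤ)) :* S) :* d
          :- ((con (+ 1) :+ X :* (con (- + 2) :+ X :* (con (- + 1) :+ X :* (con (- + 2) :+ X :* con 0ℤ))))
            :- (con (+ 1) :+ X :* (con (- + 1) :+ X :* con 0ℤ)) :* S)
      := con (+ 2) :* X :* (d :- X :* (d :* (con 1ℤ :+ c) :+ c :* (c :+ d)))
          :+ (:- (con (+ 2) :* X)) :* (c :- X :* (con 1ℤ :+ X :+ c :* (con 1ℤ :+ c))))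
      ≈-refl X c d)
    (multiple (constant (+ 2) ⊛ X) d-equation ⊞ multiple (⊝ (constant (+ 2) ⊛ X)) c-equation)
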